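{- Let $\mathcal A\subseteq\mathbb N$, $L$ an environment and $T$ a term with $L\vdash_{\mathcal A}T$. Then: (C) for all environments $L_1,L_2$, all terms $T_1,T_2$ and all $n_1,n_2\in\mathbb N$, if $L\Rightarrow L_1$, $L\Rightarrow L_2$, $L\vdash T\to^{*n_1}T_1$ and $L\vdash T\to^{*n_2}T_2$, then there exists a term $T'$ with $L_1\vdash T_1\to^{*(n_2\dot- n_1)}T'$ and $L_2\vdash T_2\to^{*(n_1\dot- n_2)}T'$; and (P) for every environment $L_2$, term $T_2$ and $n\in\mathbb N$, if $L\Rightarrow L_2$ and $L\vdash T\to^{n}T_2$, then $L_2\vdash_{\mathcal A}T_2$.
   Context: $a\dot- b$ denotes truncated subtraction ($\max(a-b,0)$). Fix a nonempty set $\Sigma$ of sorts with decidable equality, an arbitrary function $\mathrm{next}:\Sigma\to\Sigma$, and a countably infinite set of variables. Terms and environments: $T,U,V,W ::= \star s \mid x \mid \mathrm{app}(V,T) \mid \lambda x{:}W.\,T \mid \mathrm{def}(x{=}V).\,T \mid \mathrm{cast}(U,T)$ ($s\in\Sigma$) and $L,K ::= \emptyset \mid K,x{:}W \mid K,x{=}V$. $\mathrm{app}(V,T)$ applies $T$ to $V$; $\lambda x{:}W.\,T$ (de Bruijn's abstraction) and $\mathrm{def}(x{=}V).\,T$ (local definition) bind $x$ in $T$; $\mathrm{cast}(U,T)$ annotates $T$ with expected type $U$; entries $x{:}W$ (declaration) and $x{=}V$ (definition) bind $x$. Terms are modulo renaming of bound variables, with bound variables distinct from each other and from free ones. Write $\mathsf{B}x[V]$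 for either $\lambda x{:}V$ or $\mathrm{def}(x{=}V)$ and correspondingly $L,x[V]$ for $L,x{:}V$ resp. $L,x{=}V$ (same kind within a rule). One step of bound rt-reduction $L\vdash T_1\to^nT_2$ is the smallest relation closed under: $L\vdash\mathrm{app}(V,\lambda x{:}W.\,T)\to^0\mathrm{def}(x{=}\mathrm{cast}(W,V)).\,T$; $K,x{=}V\vdash x\to^0V$; $L\vdash\mathrm{def}(x{=}V).\,T\to^0T$ if $x$ not free in $T$; $L\vdash\mathrm{app}(V,\mathrm{def}(x{=}W).\,T)\to^0\mathrm{def}(x{=}W).\,\mathrm{app}(V,T)$; $L\vdash\mathrm{cast}(U,T)\to^0T$; $L\vdash\star s\to^1\star\,\mathrm{next}(s)$; $K,x{:}W\vdash x\to^1W$; $L\vdash\mathrm{cast}(U,T)\to^1U$; if $K\vdash x\to^nT$, $y\neq x$, $y$ not free in $T$ then $K,y[V]\vdash x\to^nT$; if $L\vdash V_1\to^0V_2$ then $L\vdash\mathrm{app}(V_1,T)\to^0\mathrm{app}(V_2,T)$; if $L\vdash T_1\to^nT_2$ then $L\vdash\mathrm{app}(V,T_1)\to^n\mathrm{app}(V,T_2)$; if $L\vdash V_1\to^0V_2$ then $L\vdash\mathsf Bx[V_1].\,T\to^0\mathsf Bx[V_2].\,T$; if $L,x[V]\vdash T_1\to^nT_2$ then $L\vdash\mathsf Bx[V].\,T_1\to^n\mathsf Bx[V].\,T_2$; if $L\vdash U_1\to^0U_2$ then $L\vdash\mathrm{cast}(U_1,T)\to^0\mathrm{cast}(U_2,T)$;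 if $L\vdash T_1\to^0T_2$ then $L\vdash\mathrm{cast}(U,T_1)\to^0\mathrm{cast}(U,T_2)$; if $L\vdash U_1\to^1U_2$ and $L\vdash T_1\to^1T_2$ then $L\vdash\mathrm{cast}(U_1,T_1)\to^1\mathrm{cast}(U_2,T_2)$. $L\vdash T_1\to^{*n}T_2$ is the smallest relation with $L\vdash T\to^{*0}T$, containing single steps, and with $L\vdash T_1\to^{*n_1}T$, $L\vdash T\to^{*n_2}T_2$ implying $L\vdash T_1\to^{*n_1+n_2}T_2$. One step of r-reduction for environments $L_1\Rightarrow L_2$ is the smallest relation such that $K_1\Rightarrow K_2$ implies $K_1,y[V]\Rightarrow K_2,y[V]$, and $K\vdash V_1\to^0V_2$ implies $K,y[V_1]\Rightarrow K,y[V_2]$. Validity $L\vdash_{\mathcal A}T$ is the smallest predicate closed under: $L\vdash_{\mathcal A}\star s$; if $K\vdash_{\mathcal A}V$ then $K,x[V]\vdash_{\mathcal A}x$; if $K\vdash_{\mathcal A}x$ and $y\neq x$ then $K,y[V]\vdash_{\mathcal A}x$; if $L\vdash_{\mathcal A}V$ and $L,x[V]\vdash_{\mathcal A}T$ then $L\vdash_{\mathcal A}\mathsf Bx[V].\,T$; if $L\vdash_{\mathcal A}U$, $L\vdash_{\mathcal A}T$ and some $U_0$ satisfies $L\vdash T\to^{*1}U_0$, $L\vdash U\to^{*0}U_0$, then $L\vdash_{\mathcal A}\mathrm{cast}(U,T)$; if $L\vdash_{\mathcal A}V$, $L\vdash_{\mathcal A}T$ and there are $n\in\mathcal A$, $x,W_0,U_0$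 with $L\vdash T\to^{*n}\lambda x{:}W_0.\,U_0$ and $L\vdash V\to^{*1}W_0$, then $L\vdash_{\mathcal A}\mathrm{app}(V,T)$. -}

module Defs where

-- Terms and environments of the paper, in de Bruijn representation
-- (terms modulo renaming of bound variables; index 0 = innermost binder /
-- last environment entry).

open import Data.Nat using (ℕ; zero; suc; _+_)

-- kind of binder: abst = λx:W (declaration x:W), abbr = def(x=V) (definition x=V)
data Bind : Set where
  abst abbr : Bind

data Term (S : Set) : Set where
  sort : S → Term S
  var  : ℕ → Term S
  app  : Term S → Term S → Term S          -- app(V,T): T applied to V
  bind : Bind → Term S → Term S → Term S
  cast : Term S → Term S → Term S

data Env (S : Set) : Set where
  ∅    : Env S
  snoc : Env S → Bind → Term S → Env S

liftVar : ℕ → ℕ → ℕ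
liftVar zero    i       = suc i
liftVar (suc d) zero    = zero
liftVar (suc d) (suc i) = suc (liftVar d i)

lift : {S : Set} → ℕ → Term S → Term S
lift d (sort s)     = sort s
lift d (var i)      = var (liftVar d i)
lift d (app V T)    = app (lift d V) (lift d T)
lift d (bind b W T) = bind b (lift d W) (lift (suc d) T)
lift d (cast U T)   = cast (lift d U) (lift d T)

data Step {S : Set} (next : S → S) : Env S → Term S → ℕ → Term S → Set where
  beta   : ∀ {L V W T} → Step next L (app V (bind abst W T)) 0 (bind abbr (cast W V) T)
  delta  : ∀ {K V} → Step next (snoc K abbr V) (var 0) 0 (lift 0 V)
  zeta   : ∀ {L V T} → Step next L (bind abbr V (lift 0 T)) 0 T
  theta  : ∀ {L V W T} → Step next L (app V (bind abbr W T)) 0 (bind abbr W (app (lift 0 V) T))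
  eps    : ∀ {L U T} → Step next L (cast U T) 0 T
  sortS  : ∀ {L s} → Step next L (sort s) 1 (sort (next s))
  ldec   : ∀ {K W} → Step next (snoc K abst W) (var 0) 1 (lift 0 W)
  ecast  : ∀ {L U T} → Step next L (cast U T) 1 U
  lref   : ∀ {K i n T b V} → Step next K (var i) n T →
           Step next (snoc K b V) (var (suc i)) n (lift 0 T)
  appV   : ∀ {L V₁ V₂ T} → Step next L V₁ 0 V₂ → Step next L (app V₁ T) 0 (app V₂ T)
  appT   : ∀ {L V T₁ T₂ n} → Step next L T₁ n T₂ → Step next L (app V T₁) n (app V T₂)
  bindV  : ∀ {L b V₁ V₂ T} → Step next L V₁ 0 V₂ → Step next L (bind b V₁ T) 0 (bind b V₂ T)
  bindT  : ∀ {L b V T₁ T₂ n} → Step next (snoc L b V) T₁ n T₂ →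
           Step next L (bind b V T₁) n (bind b V T₂)
  castU  : ∀ {L U₁ U₂ T} → Step next L U₁ 0 U₂ → Step next L (cast U₁ T) 0 (cast U₂ T)
  castT  : ∀ {L U T₁ T₂} → Step next L T₁ 0 T₂ → Step next L (cast U T₁) 0 (cast U T₂)
  castUT : ∀ {L U₁ U₂ T₁ T₂} → Step next L U₁ 1 U₂ → Step next L T₁ 1 T₂ →
           Step next L (cast U₁ T₁) 1 (cast U₂ T₂)

data Steps {S : Set} (next : S → S) : Env S → Term S → ℕ → Term S → Set where
  refl0 : ∀ {L T} → Steps next L T 0 T
  step  : ∀ {L T₁ n T₂} → Step next L T₁ n T₂ → Steps next L T₁ n T₂
  trans : ∀ {L T₁ n₁ T n₂ T₂} → Steps next L T₁ n₁ T → Steps next L T n₂ T₂ →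
          Steps next L T₁ (n₁ + n₂) T₂

data EStep {S : Set} (next : S → S) : Env S → Env S → Set where
  envK : ∀ {K₁ K₂ b V} → EStep next K₁ K₂ → EStep next (snoc K₁ b V) (snoc K₂ b V)
  envV : ∀ {K b V₁ V₂} → Step next K V₁ 0 V₂ → EStep next (snoc K b V₁) (snoc K b V₂)

data Valid {S : Set} (next : S → S) (A : ℕ → Set) : Env S → Term S → Set where
  vSort : ∀ {L s} → Valid next A L (sort s)
  vVar0 : ∀ {K b V} → Valid next A K V → Valid next A (snoc K b V) (var 0)
  vVarS : ∀ {K i b V} → Valid next A K (var i) → Valid next A (snoc K b V) (var (suc i))
  vBind : ∀ {L b V T} → Valid next A L V → Valid next A (snoc L b V) T →
          Valid next A L (bind b V T)
  vCast : ∀ {L U T U₀} → Valid next A L U → Valid next A L T →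
          Steps next L T 1 U₀ → Steps next L U 0 U₀ → Valid next A L (cast U T)
  vApp  : ∀ {L V T n W₀ U₀} → Valid next A L V → Valid next A L T → A n →
          Steps next L T n (bind abst W₀ U₀) → Steps next L V 1 W₀ →
          Valid next A L (app V T)

{-# OPTIONS --safe #-}
module Submission where

-- Normalisation is not needed.  Unfolding all local definitions turns terms into "pure" terms, on
-- which the type τ is a function, with τ (cast U T) = U; on valid terms an n-step computes τⁿ up to
-- r-conversion ≃.  The delicate point is that ≃ must respect τ, which fails for the contraction of
-- arbitrary casts.  So pure reduction ▷ may contract cast(U,T) to T only under the guard U ≃ τ T,
-- where ≃ is the equivalence generated by ▷ itself.  Then ▷ respects τ by induction on derivations,
-- guards survive reduction for that very reason, and ▷ has the diamond property without any typing
-- assumption.  Beta creates def(x = cast(W,V)), whose type is W as for the declaration x:W, so it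
-- commutes with τ.  Finally, a term whose casts satisfy the guards and whose applications are typed
-- up to ≃ reduces only by guarded steps (injectivity of λ yields the guard of the cast created by
-- beta), and this notion of typing coincides with validity.

open import Defs
open import Data.Nat using (ℕ; zero; suc; _+_; _∸_)
open import Data.Nat.Properties using (+-identityʳ; +-comm)
open import Data.List using (List; []; _∷_)
open import Data.Product using (∃; ∃₂; _×_; _,_; proj₁; proj₂)
open import Function using (_∘_; id)
open import Relation.Binary.Definitions using (DecidableEquality)
open import Relation.Binary.PropositionalEquality
  using (_≡_; refl; sym; cong; cong₂; subst; subst₂; _≗_) renaming (trans to _∙≡_)

-- Pure terms: renaming and substitution.

data Pure (S : Set) : Set where
  sort : S → Pure S
  var  : ℕ → Pure S
  app  : Pure S → Pure S → Pure S
  lam  : Pure S → Pure S → Pure S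
  cast : Pure S → Pure S → Pure S

infixr 6 _∙_
_∙_ : {A : Set} → A → (ℕ → A) → ℕ → A
(x ∙ f) zero    = x
(x ∙ f) (suc i) = f i

ext : (ℕ → ℕ) → ℕ → ℕ
ext ξ = zero ∙ (suc ∘ ξ)

module _ {S : Set} where

  ren : (ℕ → ℕ) → Pure S → Pure S
  ren ξ (sort s)   = sort s
  ren ξ (var i)    = var (ξ i)
  ren ξ (app V T)  = app (ren ξ V) (ren ξ T)
  ren ξ (lam W T)  = lam (ren ξ W) (ren (ext ξ) T)
  ren ξ (cast U T) = cast (ren ξ U) (ren ξ T)

  exts : (ℕ → Pure S) → ℕ → Pure S
  exts σ = var 0 ∙ (ren suc ∘ σ)

  sub : (ℕ → Pure S) → Pure S → Pure S
  sub σ (sort s)   = sort s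
  sub σ (var i)    = σ i
  sub σ (app V T)  = app (sub σ V) (sub σ T)
  sub σ (lam W T)  = lam (sub σ W) (sub (exts σ) T)
  sub σ (cast U T) = cast (sub σ U) (sub σ T)

  -- Hypotheses on maps are pointwise, here and below, so that the induction passes under a binder
  -- without function extensionality.
  sub-var : ∀ {σ} → σ ≗ var → sub σ ≗ id
  sub-var e (sort s)   = refl
  sub-var e (var i)    = e i
  sub-var e (app V T)  = cong₂ app (sub-var e V) (sub-var e T)
  sub-var e (lam W T)  = cong₂ lam (sub-var e W) (sub-var (λ where
    zero    → refl
    (suc i) → cong (ren suc) (e i)) T)
  sub-var e (cast U T) = cong₂ cast (sub-var e U) (sub-var e T)

  sub-id : ∀ T → sub var T ≡ T
  sub-id = sub-var (λ _ → refl)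

  ren≗sub : ∀ {ξ σ} → var ∘ ξ ≗ σ → ren ξ ≗ sub σ
  ren≗sub e (sort s)   = refl
  ren≗sub e (var i)    = e i
  ren≗sub e (app V T)  = cong₂ app (ren≗sub e V) (ren≗sub e T)
  ren≗sub e (lam W T)  = cong₂ lam (ren≗sub e W) (ren≗sub (λ where
    zero    → refl
    (suc i) → cong (ren suc) (e i)) T)
  ren≗sub e (cast U T) = cong₂ cast (ren≗sub e U) (ren≗sub e T)

  sub-ren : ∀ {σ ξ θ} → σ ∘ ξ ≗ θ → sub σ ∘ ren ξ ≗ sub θ
  sub-ren e (sort s)   = refl
  sub-ren e (var i)    = e i
  sub-ren e (app V T)  = cong₂ app (sub-ren e V) (sub-ren e T)
  sub-ren e (lam W T)  = cong₂ lam (sub-ren e W) (sub-ren (λ where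
    zero    → refl
    (suc i) → cong (ren suc) (e i)) T)
  sub-ren e (cast U T) = cong₂ cast (sub-ren e U) (sub-ren e T)

  ren-ren : ∀ {ξ ζ χ} → ξ ∘ ζ ≗ χ → ren ξ ∘ ren ζ ≗ ren χ
  ren-ren e (sort s)   = refl
  ren-ren e (var i)    = cong var (e i)
  ren-ren e (app V T)  = cong₂ app (ren-ren e V) (ren-ren e T)
  ren-ren e (lam W T)  = cong₂ lam (ren-ren e W) (ren-ren (λ where
    zero    → refl
    (suc i) → cong suc (e i)) T)
  ren-ren e (cast U T) = cong₂ cast (ren-ren e U) (ren-ren e T)

  ren-ext-suc : ∀ ξ T → ren (ext ξ) (ren suc T) ≡ ren suc (ren ξ T)
  ren-ext-suc ξ T = ren-ren (λ _ → refl) T ∙≡ sym (ren-ren (λ _ → refl) T)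

  ren-sub : ∀ {ξ σ θ} → ren ξ ∘ σ ≗ θ → ren ξ ∘ sub σ ≗ sub θ
  ren-sub e (sort s)   = refl
  ren-sub e (var i)    = e i
  ren-sub e (app V T)  = cong₂ app (ren-sub e V) (ren-sub e T)
  ren-sub {ξ} {σ} e (lam W T) = cong₂ lam (ren-sub e W) (ren-sub (λ where
    zero    → refl
    (suc i) → ren-ext-suc ξ (σ i) ∙≡ cong (ren suc) (e i)) T)
  ren-sub e (cast U T) = cong₂ cast (ren-sub e U) (ren-sub e T)

  exts-suc : ∀ σ T → sub (exts σ) (ren suc T) ≡ ren suc (sub σ T)
  exts-suc σ T = sub-ren (λ _ → refl) T ∙≡ sym (ren-sub (λ _ → refl) T)

  sub-sub : ∀ {σ θ χ} → sub σ ∘ θ ≗ χ → sub σ ∘ sub θ ≗ sub χ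
  sub-sub e (sort s)   = refl
  sub-sub e (var i)    = e i
  sub-sub e (app V T)  = cong₂ app (sub-sub e V) (sub-sub e T)
  sub-sub {σ} {θ} e (lam W T) = cong₂ lam (sub-sub e W) (sub-sub (λ where
    zero    → refl
    (suc i) → exts-suc σ (θ i) ∙≡ cong (ren suc) (e i)) T)
  sub-sub e (cast U T) = cong₂ cast (sub-sub e U) (sub-sub e T)

  inst-suc : ∀ X T → sub (X ∙ var) (ren suc T) ≡ T
  inst-suc X T = sub-ren (λ _ → refl) T ∙≡ sub-id T

  ren-inst : ∀ ξ X T → ren ξ (sub (X ∙ var) T) ≡ sub (ren ξ X ∙ var) (ren (ext ξ) T)
  ren-inst ξ X T = ren-sub (λ _ → refl) T ∙≡ sym (sub-ren (λ where
    zero    → refl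
    (suc i) → refl) T)

  sub-inst : ∀ σ X T → sub σ (sub (X ∙ var) T) ≡ sub (sub σ X ∙ var) (sub (exts σ) T)
  sub-inst σ X T = sub-sub (λ _ → refl) T ∙≡ sym (sub-sub (λ where
    zero    → refl
    (suc i) → inst-suc (sub σ X) (σ i)) T)

  -- Variables beyond the context are given themselves as a junk type.
  look : List (Pure S) → ℕ → Pure S
  look []      = var
  look (W ∷ Γ) = ren suc W ∙ (ren suc ∘ look Γ)

-- Guarded reduction of pure terms: types, conversion, confluence.

module Calculus {S : Set} (next : S → S) where

  private
    P = Pure S
    variable
      Γ Δ : List P
      X Y Z V V₁ V₂ W W₁ W₂ T T₁ T₂ U U₁ U₂ : P

  τ : List P → P → P
  τ Γ (sort s)   = sort (next s)
  τ Γ (var i)    = look Γ i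
  τ Γ (app V T)  = app V (τ Γ T)
  τ Γ (lam W T)  = lam W (τ (W ∷ Γ) T)
  τ Γ (cast U T) = U

  infix 3 _⊢_▷_ _⊢_≃_ _⊢_▷*_
  -- Parallel reduction in the style of Tait and Martin-Löf. `Γ` matters only through the guard of
  -- `▷eps`, whose two sides belong to the cast before reduction.
  data _⊢_▷_ : List P → P → P → Set
  data _⊢_≃_ (Γ : List P) : P → P → Set

  data _⊢_▷_ where
    ▷sort : ∀ {s} → Γ ⊢ sort s ▷ sort s
    ▷var  : ∀ {i} → Γ ⊢ var i ▷ var i
    ▷app  : Γ ⊢ V₁ ▷ V₂ → Γ ⊢ T₁ ▷ T₂ → Γ ⊢ app V₁ T₁ ▷ app V₂ T₂
    ▷lam  : Γ ⊢ W₁ ▷ W₂ → W₁ ∷ Γ ⊢ T₁ ▷ T₂ → Γ ⊢ lam W₁ T₁ ▷ lam W₂ T₂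
    ▷cast : Γ ⊢ U₁ ▷ U₂ → Γ ⊢ T₁ ▷ T₂ → Γ ⊢ cast U₁ T₁ ▷ cast U₂ T₂
    ▷beta : Γ ⊢ V₁ ▷ V₂ → Γ ⊢ W₁ ▷ W₂ → W₁ ∷ Γ ⊢ T₁ ▷ T₂ →
            Γ ⊢ app V₁ (lam W₁ T₁) ▷ sub (cast W₂ V₂ ∙ var) T₂
    ▷eps  : Γ ⊢ U ≃ τ Γ T₁ → Γ ⊢ T₁ ▷ T₂ → Γ ⊢ cast U T₁ ▷ T₂

  data _⊢_≃_ Γ where
    ≃step  : Γ ⊢ X ▷ Y → Γ ⊢ X ≃ Y
    ≃sym   : Γ ⊢ X ≃ Y → Γ ⊢ Y ≃ X
    ≃trans : Γ ⊢ X ≃ Y → Γ ⊢ Y ≃ Z → Γ ⊢ X ≃ Z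

  ▷refl : ∀ T → Γ ⊢ T ▷ T
  ▷refl (sort s)   = ▷sort
  ▷refl (var i)    = ▷var
  ▷refl (app V T)  = ▷app (▷refl V) (▷refl T)
  ▷refl (lam W T)  = ▷lam (▷refl W) (▷refl T)
  ▷refl (cast U T) = ▷cast (▷refl U) (▷refl T)

  ≃refl : Γ ⊢ X ≃ X
  ≃refl = ≃step (▷refl _)

  ≡⇒≃ : X ≡ Y → Γ ⊢ X ≃ Y
  ≡⇒≃ refl = ≃refl

  ≃map : (F : P → P) → (∀ {X Y} → Γ ⊢ X ▷ Y → Δ ⊢ F X ▷ F Y) →
         Γ ⊢ X ≃ Y → Δ ⊢ F X ≃ F Y
  ≃map F h (≃step p)    = ≃step (h p)
  ≃map F h (≃sym p)     = ≃sym (≃map F h p)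
  ≃map F h (≃trans p q) = ≃trans (≃map F h p) (≃map F h q)

  ≃app : Γ ⊢ V₁ ≃ V₂ → Γ ⊢ T₁ ≃ T₂ → Γ ⊢ app V₁ T₁ ≃ app V₂ T₂
  ≃app p q = ≃trans (≃map (λ V → app V _) (λ d → ▷app d (▷refl _)) p)
                    (≃map (app _) (▷app (▷refl _)) q)

  ≃cast : Γ ⊢ U₁ ≃ U₂ → Γ ⊢ T₁ ≃ T₂ → Γ ⊢ cast U₁ T₁ ≃ cast U₂ T₂
  ≃cast p q = ≃trans (≃map (λ V → cast V _) (λ d → ▷cast d (▷refl _)) p)
                     (≃map (cast _) (▷cast (▷refl _)) q)

  ≃lam : Γ ⊢ W₁ ≃ W₂ → W₂ ∷ Γ ⊢ T₁ ≃ T₂ → Γ ⊢ lam W₁ T₁ ≃ lam W₂ T₂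
  ≃lam p q = ≃trans (≃map (λ V → lam V _) (λ d → ▷lam d (▷refl _)) p)
                    (≃map (lam _) (▷lam (▷refl _)) q)

  record RenWt (Δ Γ : List P) (ξ : ℕ → ℕ) : Set where
    field ren-at : ∀ x → look Γ (ξ x) ≡ ren ξ (look Δ x)
  open RenWt

  ext-wt : ∀ {ξ} → RenWt Δ Γ ξ → RenWt (W ∷ Δ) (ren ξ W ∷ Γ) (ext ξ)
  ext-wt {W = W} {ξ} h .ren-at zero = sym (ren-ext-suc ξ W)
  ext-wt {Δ} {ξ = ξ} h .ren-at (suc x) = cong (ren suc) (h .ren-at x) ∙≡ sym (ren-ext-suc ξ (look Δ x))

  τ-ren : ∀ {ξ} → RenWt Δ Γ ξ → ∀ T → τ Γ (ren ξ T) ≡ ren ξ (τ Δ T)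
  τ-ren h (sort s)   = refl
  τ-ren h (var i)    = h .ren-at i
  τ-ren h (app V T)  = cong (app _) (τ-ren h T)
  τ-ren h (lam W T)  = cong (lam _) (τ-ren (ext-wt h) T)
  τ-ren h (cast U T) = refl

  ▷ren : ∀ {ξ} → RenWt Δ Γ ξ → Δ ⊢ X ▷ Y → Γ ⊢ ren ξ X ▷ ren ξ Y
  ≃ren : ∀ {ξ} → RenWt Δ Γ ξ → Δ ⊢ X ≃ Y → Γ ⊢ ren ξ X ≃ ren ξ Y
  ▷ren h ▷sort = ▷sort
  ▷ren h ▷var = ▷var
  ▷ren h (▷app v t) = ▷app (▷ren h v) (▷ren h t)
  ▷ren h (▷lam w t) = ▷lam (▷ren h w) (▷ren (ext-wt h) t)
  ▷ren h (▷cast u t) = ▷cast (▷ren h u) (▷ren h t)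
  ▷ren {ξ = ξ} h (▷beta {V₂ = V₂} {W₂ = W₂} {T₂ = T₂} v w t) =
    subst (_ ⊢ _ ▷_) (sym (ren-inst ξ (cast W₂ V₂) T₂))
      (▷beta (▷ren h v) (▷ren h w) (▷ren (ext-wt h) t))
  ▷ren h (▷eps {T₁ = T₁} g t) =
    ▷eps (subst (_ ⊢ _ ≃_) (sym (τ-ren h T₁)) (≃ren h g)) (▷ren h t)
  ≃ren h (≃step p)    = ≃step (▷ren h p)
  ≃ren h (≃sym p)     = ≃sym (≃ren h p)
  ≃ren h (≃trans p q) = ≃trans (≃ren h p) (≃ren h q)

  suc-wt : RenWt Γ (W ∷ Γ) suc
  suc-wt .ren-at x = refl

  -- Agreement up to `≃` instead of equality makes conversion of the context the special case
  -- `σ = var`.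
  record SubWt (Δ Γ : List P) (σ : ℕ → P) : Set where
    field sub-at : ∀ x → Γ ⊢ τ Γ (σ x) ≃ sub σ (look Δ x)
  open SubWt

  cons-wt : ∀ {σ} → SubWt Δ Γ σ → Γ ⊢ W₁ ≃ sub σ W → SubWt (W ∷ Δ) (W₁ ∷ Γ) (exts σ)
  cons-wt {W = W} {σ} h p .sub-at zero =
    subst (_ ⊢ _ ≃_) (sym (exts-suc σ W)) (≃ren suc-wt p)
  cons-wt {Δ} {σ = σ} h p .sub-at (suc x) =
    subst₂ (_ ⊢_≃_) (sym (τ-ren suc-wt (σ x))) (sym (exts-suc σ (look Δ x))) (≃ren suc-wt (h .sub-at x))

  exts-wt : ∀ {σ} → SubWt Δ Γ σ → SubWt (W ∷ Δ) (sub σ W ∷ Γ) (exts σ)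
  exts-wt h = cons-wt h ≃refl

  -- The argument is substituted inside a cast to `W₁`, so its type is `W₁` whatever `V` is.
  inst-wt : Γ ⊢ W₁ ≃ W → SubWt (W ∷ Γ) Γ (cast W₁ V ∙ var)
  inst-wt p .sub-at zero    = ≃trans p (≡⇒≃ (sym (inst-suc _ _)))
  inst-wt p .sub-at (suc x) = ≡⇒≃ (sym (inst-suc _ _))

  id-wt : SubWt Γ Γ var
  id-wt .sub-at x = ≡⇒≃ (sym (sub-id _))

  τ-sub : ∀ {σ} → SubWt Δ Γ σ → ∀ T → Γ ⊢ τ Γ (sub σ T) ≃ sub σ (τ Δ T)
  τ-sub h (sort s)   = ≃refl
  τ-sub h (var i)    = h .sub-at i
  τ-sub h (app V T)  = ≃app ≃refl (τ-sub h T)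
  τ-sub h (lam W T)  = ≃lam ≃refl (τ-sub (exts-wt h) T)
  τ-sub h (cast U T) = ≃refl

  -- Guards speak of terms before reduction, and these are instantiated by `σ`; `τ-sub` therefore
  -- restores each guard up to `≃`.
  ▷sub : ∀ {σ θ} → SubWt Δ Γ σ → (∀ x → Γ ⊢ σ x ▷ θ x) → Δ ⊢ X ▷ Y → Γ ⊢ sub σ X ▷ sub θ Y
  ≃sub : ∀ {σ} → SubWt Δ Γ σ → Δ ⊢ X ≃ Y → Γ ⊢ sub σ X ≃ sub σ Y

  ▷exts : ∀ {σ θ} → (∀ x → Γ ⊢ σ x ▷ θ x) → ∀ x → W ∷ Γ ⊢ exts σ x ▷ exts θ x
  ▷exts s zero    = ▷var
  ▷exts s (suc x) = ▷ren suc-wt (s x)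

  ▷sub h s ▷sort = ▷sort
  ▷sub h s ▷var = s _
  ▷sub h s (▷app v t) = ▷app (▷sub h s v) (▷sub h s t)
  ▷sub h s (▷lam w t) = ▷lam (▷sub h s w) (▷sub (exts-wt h) (▷exts s) t)
  ▷sub h s (▷cast u t) = ▷cast (▷sub h s u) (▷sub h s t)
  ▷sub {θ = θ} h s (▷beta {V₂ = V₂} {W₂ = W₂} {T₂ = T₂} v w t) =
    subst (_ ⊢ _ ▷_) (sym (sub-inst θ (cast W₂ V₂) T₂))
      (▷beta (▷sub h s v) (▷sub h s w) (▷sub (exts-wt h) (▷exts s) t))
  ▷sub h s (▷eps {T₁ = T₁} g t) =
    ▷eps (≃trans (≃sub h g) (≃sym (τ-sub h T₁))) (▷sub h s t)
  ≃sub h (≃step p)    = ≃step (▷sub h (λ x → ▷refl _) p)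
  ≃sub h (≃sym p)     = ≃sym (≃sub h p)
  ≃sub h (≃trans p q) = ≃trans (≃sub h p) (≃sub h q)

  ≃conv : SubWt Δ Γ var → Δ ⊢ X ≃ Y → Γ ⊢ X ≃ Y
  ≃conv h p = subst₂ (_ ⊢_≃_) (sub-id _) (sub-id _) (≃sub h p)

  ▷conv : SubWt Δ Γ var → Δ ⊢ X ▷ Y → Γ ⊢ X ▷ Y
  ▷conv h p = subst₂ (_ ⊢_▷_) (sub-id _) (sub-id _) (▷sub h (λ _ → ▷var) p)

  τ-conv : SubWt Δ Γ var → ∀ T → Γ ⊢ τ Γ T ≃ τ Δ T
  τ-conv h T = subst₂ (λ X Y → _ ⊢ τ _ X ≃ Y) (sub-id T) (sub-id (τ _ T)) (τ-sub h T)

  cons-conv : SubWt Δ Γ var → Γ ⊢ W₁ ≃ W → SubWt (W ∷ Δ) (W₁ ∷ Γ) var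
  cons-conv h p .sub-at zero = ≃trans (≃ren suc-wt p) (≡⇒≃ (sym (sub-id _)))
  cons-conv {Δ} h p .sub-at (suc x) = subst (_ ⊢ _ ≃_)
    (cong (ren suc) (sub-id (look Δ x)) ∙≡ sym (sub-id _)) (≃ren suc-wt (h .sub-at x))

  head-wt : Γ ⊢ W ▷ W₁ → SubWt (W ∷ Γ) (W₁ ∷ Γ) var
  head-wt p = cons-conv id-wt (≃sym (≃step p))

  -- For `▷eps` the guard is the required conversion. For `▷beta` the type of the redex is again a
  -- beta redex; contracting it gives the type of the contractum by `τ-sub`, since the inserted cast
  -- has type `W₂ ≃ W₁`.
  ▷τ : Γ ⊢ X ▷ Y → Γ ⊢ τ Γ X ≃ τ Γ Y
  ▷τ ▷sort = ≃refl
  ▷τ ▷var = ≃refl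
  ▷τ (▷app v t) = ≃app (≃step v) (▷τ t)
  ▷τ (▷lam {T₂ = T₂} w t) =
    ≃lam (≃step w) (≃trans (≃conv (head-wt w) (▷τ t)) (≃sym (τ-conv (head-wt w) T₂)))
  ▷τ (▷cast u t) = ≃step u
  ▷τ (▷beta {T₂ = T₂} v w t) = ≃trans (≃app ≃refl (≃lam ≃refl (▷τ t)))
    (≃trans (≃step (▷beta v w (▷refl _))) (≃sym (τ-sub (inst-wt (≃sym (≃step w))) T₂)))
  ▷τ (▷eps g t) = ≃trans g (▷τ t)

  ≃τ : Γ ⊢ X ≃ Y → Γ ⊢ τ Γ X ≃ τ Γ Y
  ≃τ (≃step p)    = ▷τ p
  ≃τ (≃sym p)     = ≃sym (≃τ p)
  ≃τ (≃trans p q) = ≃trans (≃τ p) (≃τ q)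

  ▷inst : Γ ⊢ V₁ ▷ V₂ → Γ ⊢ W ▷ W₁ → Γ ⊢ W₁ ▷ W₂ → W ∷ Γ ⊢ T₁ ▷ T₂ →
          Γ ⊢ sub (cast W₁ V₁ ∙ var) T₁ ▷ sub (cast W₂ V₂ ∙ var) T₂
  ▷inst v w w′ t = ▷sub (inst-wt (≃sym (≃step w))) (λ where
    zero    → ▷cast w′ v
    (suc x) → ▷var) t

  -- Where a λ is reduced by congruence, the joining step of its body is moved under the new domain
  -- by `head-wt`. Where a cast is contracted on one side and reduced on the other, its guard
  -- survives: `≃` absorbs the step of `U`, and `▷τ` the step of `T`.
  diamond : Γ ⊢ X ▷ Y → Γ ⊢ X ▷ Z → ∃ λ R → Γ ⊢ Y ▷ R × Γ ⊢ Z ▷ R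
  diamond ▷sort ▷sort = _ , ▷sort , ▷sort
  diamond ▷var ▷var = _ , ▷var , ▷var
  diamond (▷app v t) (▷app v′ t′) with diamond v v′ | diamond t t′
  ... | _ , a , b | _ , c , d = _ , ▷app a c , ▷app b d
  diamond (▷app v (▷lam w t)) (▷beta v′ w′ t′) with diamond v v′ | diamond w w′ | diamond t t′
  ... | _ , a , b | _ , c , d | _ , e , f =
    _ , ▷beta a c (▷conv (head-wt w) e) , ▷inst b w′ d f
  diamond (▷lam w t) (▷lam w′ t′) with diamond w w′ | diamond t t′
  ... | _ , a , b | _ , c , d =
    _ , ▷lam a (▷conv (head-wt w) c) , ▷lam b (▷conv (head-wt w′) d)
  diamond (▷cast u t) (▷cast u′ t′) with diamond u u′ | diamond t t′
  ... | _ , a , b | _ , c , d = _ , ▷cast a c , ▷cast b d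
  diamond (▷cast u t) (▷eps g t′) with diamond t t′
  ... | _ , c , d = _ , ▷eps (≃trans (≃sym (≃step u)) (≃trans g (▷τ t))) c , d
  diamond (▷beta v w t) (▷app v′ (▷lam w′ t′)) with diamond v v′ | diamond w w′ | diamond t t′
  ... | _ , a , b | _ , c , d | _ , e , f =
    _ , ▷inst a w c e , ▷beta b d (▷conv (head-wt w′) f)
  diamond (▷beta v w t) (▷beta v′ w′ t′) with diamond v v′ | diamond w w′ | diamond t t′
  ... | _ , a , b | _ , c , d | _ , e , f = _ , ▷inst a w c e , ▷inst b w′ d f
  diamond (▷eps g t) (▷cast u′ t′) with diamond t t′
  ... | _ , c , d = _ , c , ▷eps (≃trans (≃sym (≃step u′)) (≃trans g (▷τ t′))) d
  diamond (▷eps g t) (▷eps g′ t′) = diamond t t′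

  data _⊢_▷*_ (Γ : List P) : P → P → Set where
    ε   : Γ ⊢ X ▷* X
    _◅_ : Γ ⊢ X ▷ Y → Γ ⊢ Y ▷* Z → Γ ⊢ X ▷* Z

  _◅◅_ : Γ ⊢ X ▷* Y → Γ ⊢ Y ▷* Z → Γ ⊢ X ▷* Z
  ε ◅◅ q = q
  (d ◅ p) ◅◅ q = d ◅ (p ◅◅ q)

  strip : Γ ⊢ X ▷ Y → Γ ⊢ X ▷* Z → ∃ λ R → Γ ⊢ Y ▷* R × Γ ⊢ Z ▷ R
  strip d ε = _ , ε , d
  strip d (e ◅ p) with diamond d e
  ... | _ , a , b with strip b p
  ... | _ , q , c = _ , a ◅ q , c

  confluence : Γ ⊢ X ▷* Y → Γ ⊢ X ▷* Z → ∃ λ R → Γ ⊢ Y ▷* R × Γ ⊢ Z ▷* R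
  confluence ε q = _ , q , ε
  confluence (d ◅ p) q with strip d q
  ... | _ , r , b with confluence p r
  ... | _ , s , t = _ , s , b ◅ t

  church-rosser : Γ ⊢ X ≃ Y → ∃ λ R → Γ ⊢ X ▷* R × Γ ⊢ Y ▷* R
  church-rosser (≃step d) = _ , d ◅ ε , ε
  church-rosser (≃sym p) with church-rosser p
  ... | _ , a , b = _ , b , a
  church-rosser (≃trans p q) with church-rosser p | church-rosser q
  ... | _ , a , b | _ , c , d with confluence b c
  ... | _ , e , f = _ , a ◅◅ e , d ◅◅ f

  lam▷* : Γ ⊢ lam W T ▷* X → ∃₂ λ W₁ T₁ → X ≡ lam W₁ T₁ × Γ ⊢ W ≃ W₁
  lam▷* ε = _ , _ , refl , ≃refl
  lam▷* (▷lam w t ◅ p) with lam▷* p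
  ... | _ , _ , e , q = _ , _ , e , ≃trans (≃step w) q

  lam-injective : Γ ⊢ lam W₁ T₁ ≃ lam W₂ T₂ → Γ ⊢ W₁ ≃ W₂
  lam-injective p with church-rosser p
  ... | _ , a , b with lam▷* a | lam▷* b
  ... | _ , _ , refl , q | _ , _ , refl , r = ≃trans q (≃sym r)

  ty : ℕ → List P → P → P
  ty zero    Γ T = T
  ty (suc n) Γ T = ty n Γ (τ Γ T)

  ty-+ : ∀ m n Γ T → ty (m + n) Γ T ≡ ty n Γ (ty m Γ T)
  ty-+ zero    n Γ T = refl
  ty-+ (suc m) n Γ T = ty-+ m n Γ (τ Γ T)

  ty-app : ∀ n V T → ty n Γ (app V T) ≡ app V (ty n Γ T)
  ty-app zero    V T = refl
  ty-app (suc n) V T = ty-app n V (τ _ T)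

  ty-lam : ∀ n W T → ty n Γ (lam W T) ≡ lam W (ty n (W ∷ Γ) T)
  ty-lam zero    W T = refl
  ty-lam (suc n) W T = ty-lam n W (τ _ T)

  ≃ty : ∀ n → Γ ⊢ X ≃ Y → Γ ⊢ ty n Γ X ≃ ty n Γ Y
  ≃ty zero    p = p
  ≃ty (suc n) p = ≃ty n (≃τ p)

  ty-sub : ∀ {σ} → SubWt Δ Γ σ → ∀ n T → Γ ⊢ ty n Γ (sub σ T) ≃ sub σ (ty n Δ T)
  ty-sub h zero    T = ≃refl
  ty-sub h (suc n) T = ≃trans (≃ty n (τ-sub h T)) (ty-sub h n (τ _ T))

  ty-conv : SubWt Δ Γ var → ∀ n T → Γ ⊢ ty n Γ T ≃ ty n Δ T
  ty-conv h n T = subst₂ (λ X Y → _ ⊢ ty n _ X ≃ Y) (sub-id T) (sub-id (ty n _ T)) (ty-sub h n T)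

  ≃unsub : Γ ⊢ sub var X ≃ Y → Γ ⊢ X ≃ Y
  ≃unsub p = ≃trans (≡⇒≃ (sym (sub-id _))) p

-- Terms and pure terms: lifting, unfolding of definitions, reading back.

module _ {S : Set} where

  renT : (ℕ → ℕ) → Term S → Term S
  renT ξ (sort s)     = sort s
  renT ξ (var i)      = var (ξ i)
  renT ξ (app V T)    = app (renT ξ V) (renT ξ T)
  renT ξ (bind b V T) = bind b (renT ξ V) (renT (ext ξ) T)
  renT ξ (cast U T)   = cast (renT ξ U) (renT ξ T)

  renT-id : ∀ {ξ} → ξ ≗ id → renT ξ ≗ id
  renT-id e (sort s)     = refl
  renT-id e (var i)      = cong var (e i)
  renT-id e (app V T)    = cong₂ app (renT-id e V) (renT-id e T)
  renT-id e (bind b V T) = cong₂ (bind b) (renT-id e V) (renT-id (λ where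
    zero    → refl
    (suc i) → cong suc (e i)) T)
  renT-id e (cast U T)   = cong₂ cast (renT-id e U) (renT-id e T)

  renT-∘ : ∀ {ξ ζ χ} → ξ ∘ ζ ≗ χ → renT ξ ∘ renT ζ ≗ renT χ
  renT-∘ e (sort s)     = refl
  renT-∘ e (var i)      = cong var (e i)
  renT-∘ e (app V T)    = cong₂ app (renT-∘ e V) (renT-∘ e T)
  renT-∘ e (bind b V T) = cong₂ (bind b) (renT-∘ e V) (renT-∘ (λ where
    zero    → refl
    (suc i) → cong suc (e i)) T)
  renT-∘ e (cast U T)   = cong₂ cast (renT-∘ e U) (renT-∘ e T)

  lift≗renT : ∀ {d ξ} → liftVar d ≗ ξ → lift d ≗ renT ξ
  lift≗renT e (sort s)     = refl
  lift≗renT e (var i)      = cong var (e i)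
  lift≗renT e (app V T)    = cong₂ app (lift≗renT e V) (lift≗renT e T)
  lift≗renT e (bind b V T) = cong₂ (bind b) (lift≗renT e V) (lift≗renT (λ where
    zero    → refl
    (suc i) → cong suc (e i)) T)
  lift≗renT e (cast U T)   = cong₂ cast (lift≗renT e U) (lift≗renT e T)

  lift-lift : ∀ d T → lift (suc d) (lift 0 T) ≡ lift 0 (lift d T)
  lift-lift d T =
    two (suc d) 0 ∙≡ (renT-∘ (λ _ → refl) T ∙≡ sym (two 0 d ∙≡ renT-∘ (λ _ → refl) T))
    where
    two : ∀ m n → lift m (lift n T) ≡ renT (liftVar m) (renT (liftVar n) T)
    two m n = lift≗renT (λ _ → refl) (lift n T) ∙≡ cong (renT _) (lift≗renT (λ _ → refl) T)

  -- A definition takes a position of `ρ` but no pure variable, so the indices of terms and of pure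
  -- terms drift apart. `ρ` bridges them in this direction, and the argument `pos` of `embed` in the
  -- other.
  ⟦_⟧ : Term S → (ℕ → Pure S) → Pure S
  ⟦ sort s ⟧        ρ = sort s
  ⟦ var i ⟧         ρ = ρ i
  ⟦ app V T ⟧       ρ = app (⟦ V ⟧ ρ) (⟦ T ⟧ ρ)
  ⟦ bind abst W T ⟧ ρ = lam (⟦ W ⟧ ρ) (⟦ T ⟧ (exts ρ))
  ⟦ bind abbr V T ⟧ ρ = ⟦ T ⟧ (⟦ V ⟧ ρ ∙ ρ)
  ⟦ cast U T ⟧      ρ = cast (⟦ U ⟧ ρ) (⟦ T ⟧ ρ)

  embed : (ℕ → ℕ) → Pure S → Term S
  embed pos (sort s)   = sort s
  embed pos (var i)    = var (pos i)
  embed pos (app V T)  = app (embed pos V) (embed pos T)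
  embed pos (lam W T)  = bind abst (embed pos W) (embed (ext pos) T)
  embed pos (cast U T) = cast (embed pos U) (embed pos T)

  renT-embed : ∀ {ξ ζ χ} → ξ ∘ ζ ≗ χ → renT ξ ∘ embed ζ ≗ embed χ
  renT-embed e (sort s)   = refl
  renT-embed e (var i)    = cong var (e i)
  renT-embed e (app V T)  = cong₂ app (renT-embed e V) (renT-embed e T)
  renT-embed e (lam W T)  = cong₂ (bind abst) (renT-embed e W) (renT-embed (λ where
    zero    → refl
    (suc i) → cong suc (e i)) T)
  renT-embed e (cast U T) = cong₂ cast (renT-embed e U) (renT-embed e T)

  embed-ren : ∀ {ξ ζ χ} → ξ ∘ ζ ≗ χ → embed ξ ∘ ren ζ ≗ embed χ
  embed-ren e (sort s)   = refl
  embed-ren e (var i)    = cong var (e i)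
  embed-ren e (app V T)  = cong₂ app (embed-ren e V) (embed-ren e T)
  embed-ren e (lam W T)  = cong₂ (bind abst) (embed-ren e W) (embed-ren (λ where
    zero    → refl
    (suc i) → cong suc (e i)) T)
  embed-ren e (cast U T) = cong₂ cast (embed-ren e U) (embed-ren e T)

  lift-embed : ∀ pos X → lift 0 (embed pos X) ≡ embed (suc ∘ pos) X
  lift-embed pos X = lift≗renT (λ _ → refl) (embed pos X) ∙≡ renT-embed (λ _ → refl) X

  lift-embed-ext : ∀ pos X → lift 0 (embed pos X) ≡ embed (ext pos) (ren suc X)
  lift-embed-ext pos X = lift-embed pos X ∙≡ sym (embed-ren (λ _ → refl) X)

  data Ins : ℕ → Env S → Env S → Set where
    here  : ∀ {K b V} → Ins 0 K (snoc K b V)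
    there : ∀ {d K K′ b V} → Ins d K K′ → Ins (suc d) (snoc K b V) (snoc K′ b (lift d V))

-- Simulation of pure reduction in the original calculus.

module Reduction {S : Set} (next : S → S) where

  private
    _⊢_⟶[_]_ : Env S → Term S → ℕ → Term S → Set
    _⊢_⟶[_]_ = Step next
    _⊢_⟶*[_]_ : Env S → Term S → ℕ → Term S → Set
    _⊢_⟶*[_]_ = Steps next
    variable
      K L L′ : Env S
      T T₁ T₂ T₃ U U₁ U₂ V V₁ V₂ : Term S
      b : Bind
      d m n : ℕ

  _⟶≡_ : L ⊢ T₁ ⟶[ n ] T₂ → T₂ ≡ T₃ → L ⊢ T₁ ⟶[ n ] T₃
  s ⟶≡ refl = s

  _⟶*≡_ : L ⊢ T₁ ⟶*[ n ] T₂ → T₂ ≡ T₃ → L ⊢ T₁ ⟶*[ n ] T₃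
  p ⟶*≡ refl = p

  zeta≡ : T₁ ≡ lift 0 T₂ → L ⊢ bind abbr V T₁ ⟶[ 0 ] T₂
  zeta≡ refl = zeta

  theta≡ : U ≡ lift 0 V → L ⊢ app V (bind abbr T₁ T₂) ⟶[ 0 ] bind abbr T₁ (app U T₂)
  theta≡ refl = theta

  step-lift : Ins d L L′ → L ⊢ T₁ ⟶[ n ] T₂ → L′ ⊢ lift d T₁ ⟶[ n ] lift d T₂
  step-lift j beta = beta
  step-lift here delta = lref delta
  step-lift (there {d} j) (delta {V = V}) = delta ⟶≡ sym (lift-lift d V)
  step-lift {d} j (zeta {V = V} {T = T}) = zeta≡ (lift-lift d T)
  step-lift {d} j (theta {V = V}) = theta≡ (lift-lift d V)
  step-lift j eps = eps
  step-lift j sortS = sortS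
  step-lift here ldec = lref ldec
  step-lift (there {d} j) (ldec {W = W}) = ldec ⟶≡ sym (lift-lift d W)
  step-lift j ecast = ecast
  step-lift here (lref s) = lref (lref s)
  step-lift (there {d} j) (lref {T = T} s) = lref (step-lift j s) ⟶≡ sym (lift-lift d T)
  step-lift j (appV s) = appV (step-lift j s)
  step-lift j (appT s) = appT (step-lift j s)
  step-lift j (bindV s) = bindV (step-lift j s)
  step-lift j (bindT s) = bindT (step-lift (there j) s)
  step-lift j (castU s) = castU (step-lift j s)
  step-lift j (castT s) = castT (step-lift j s)
  step-lift j (castUT s t) = castUT (step-lift j s) (step-lift j t)

  steps-map : (F : Term S → Term S) → (∀ {n T₁ T₂} → K ⊢ T₁ ⟶[ n ] T₂ → L ⊢ F T₁ ⟶[ n ] F T₂) →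
              K ⊢ T₁ ⟶*[ n ] T₂ → L ⊢ F T₁ ⟶*[ n ] F T₂
  steps-map F h refl0       = refl0
  steps-map F h (step s)    = step (h s)
  steps-map F h (trans p q) = trans (steps-map F h p) (steps-map F h q)

  steps-lift : L ⊢ T₁ ⟶*[ n ] T₂ → snoc L b V ⊢ lift 0 T₁ ⟶*[ n ] lift 0 T₂
  steps-lift = steps-map (lift 0) (step-lift here)

  -- Serves the congruences that exist for count 0 only, such as `appV` and `bindV`. The count is a
  -- variable with an equation because `n₁ + n₂` in `trans` does not unify with 0.
  steps₀-map : (F : Term S → Term S) → (∀ {T₁ T₂} → K ⊢ T₁ ⟶[ 0 ] T₂ → L ⊢ F T₁ ⟶[ 0 ] F T₂) →
               n ≡ 0 → K ⊢ T₁ ⟶*[ n ] T₂ → L ⊢ F T₁ ⟶*[ 0 ] F T₂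
  steps₀-map F h e refl0 = refl0
  steps₀-map F h refl (step s) = step (h s)
  steps₀-map F h e (trans {n₁ = zero} p q) = trans (steps₀-map F h refl p) (steps₀-map F h e q)
  steps₀-map F h () (trans {n₁ = suc _} p q)

  _▸₀_ : L ⊢ T₁ ⟶*[ n ] T₂ → L ⊢ T₂ ⟶*[ 0 ] T₃ → L ⊢ T₁ ⟶*[ n ] T₃
  p ▸₀ q = subst (λ n → _ ⊢ _ ⟶*[ n ] _) (+-identityʳ _) (trans p q)

  app* : L ⊢ V₁ ⟶*[ 0 ] V₂ → L ⊢ T₁ ⟶*[ 0 ] T₂ → L ⊢ app V₁ T₁ ⟶*[ 0 ] app V₂ T₂
  app* p q = trans (steps₀-map (λ V → app V _) appV refl p) (steps-map (app _) appT q)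

  bind* : L ⊢ V₁ ⟶*[ 0 ] V₂ → snoc L b V₁ ⊢ T₁ ⟶*[ 0 ] T₂ → L ⊢ bind b V₁ T₁ ⟶*[ 0 ] bind b V₂ T₂
  bind* p q = trans (steps-map (bind _ _) bindT q) (steps₀-map (λ V → bind _ V _) bindV refl p)

  cast* : L ⊢ U₁ ⟶*[ 0 ] U₂ → L ⊢ T₁ ⟶*[ 0 ] T₂ → L ⊢ cast U₁ T₁ ⟶*[ 0 ] cast U₂ T₂
  cast* p q = trans (steps₀-map (λ U → cast U _) castU refl p) (steps₀-map (cast _) castT refl q)

  -- Substitution is carried out occurrence by occurrence: `ξ` places the variables to be replaced,
  -- `ζ` those of their values.
  embed-sub : ∀ {ξ ζ σ} → (∀ i → L ⊢ var (ξ i) ⟶*[ 0 ] embed ζ (σ i)) →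
           ∀ X → L ⊢ embed ξ X ⟶*[ 0 ] embed ζ (sub σ X)
  embed-sub h (sort s) = refl0
  embed-sub h (var i) = h i
  embed-sub h (app V T) = app* (embed-sub h V) (embed-sub h T)
  embed-sub {ζ = ζ} {σ} h (lam W T) = bind* (embed-sub h W) (embed-sub (λ where
    zero    → refl0
    (suc i) → steps-lift (h i) ⟶*≡ lift-embed-ext ζ (σ i)) T)
  embed-sub h (cast U T) = cast* (embed-sub h U) (embed-sub h T)

  open Calculus next

  -- A parallel beta becomes `beta`, then `delta` at every occurrence of the new definition, then
  -- `zeta`. The definition occupies position 0, so the substituted body is read back along
  -- `suc ∘ pos` and is visibly a lifted term.
  embed-▷ : ∀ {Γ X Y} → Γ ⊢ X ▷ Y → ∀ pos → L ⊢ embed pos X ⟶*[ 0 ] embed pos Y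
  embed-▷ ▷sort pos = refl0
  embed-▷ ▷var pos = refl0
  embed-▷ (▷app v t) pos = app* (embed-▷ v pos) (embed-▷ t pos)
  embed-▷ (▷lam w t) pos = bind* (embed-▷ w pos) (embed-▷ t (ext pos))
  embed-▷ (▷cast u t) pos = cast* (embed-▷ u pos) (embed-▷ t pos)
  embed-▷ {L} (▷beta {V₂ = V} {W₂ = W} {T₂ = T} v w t) pos =
    trans (app* (embed-▷ v pos) (bind* (embed-▷ w pos) (embed-▷ t (ext pos))))
      (trans (step beta) (trans (bind* refl0 (embed-sub args T))
        (step (zeta≡ (sym (lift-embed pos (sub (cast W V ∙ var) T)))))))
    where
    args : ∀ i → snoc L abbr (embed pos (cast W V)) ⊢
               var (ext pos i) ⟶*[ 0 ] embed (suc ∘ pos) ((cast W V ∙ var) i)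
    args zero    = step (delta ⟶≡ lift-embed pos (cast W V))
    args (suc i) = refl0
  embed-▷ (▷eps g t) pos = trans (step eps) (embed-▷ t pos)

  embed-▷* : ∀ {Γ X Y} → Γ ⊢ X ▷* Y → ∀ pos → L ⊢ embed pos X ⟶*[ 0 ] embed pos Y
  embed-▷* ε pos = refl0
  embed-▷* (d ◅ p) pos = trans (embed-▷ d pos) (embed-▷* p pos)

-- Typing up to conversion, and its transport between environments.

module Typing {S : Set} (next : S → S) (A : ℕ → Set) where

  open Calculus next
  open SubWt
  open Reduction next

  -- Validity of T in L does not make the entries of L valid that T does not use, and an arbitrary
  -- step may take place in such an entry.  These entries are flagged as junk; they receive no pure
  -- variable and the junk value var 0, and Typed excludes any reference to them.
  data Flags : Env S → Set where
    ∅    : Flags ∅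
    good : ∀ {K} b V → Flags K → Flags (snoc K b V)
    junk : ∀ {K} b V → Flags K → Flags (snoc K b V)

  private
    variable
      K L L′ : Env S
      T T₁ T₂ U V V₁ V₂ W W₁ : Term S
      b : Bind
      i n : ℕ
      f f′ g h : Flags L
      ξ ζ : ℕ → ℕ
      σ : ℕ → Pure S

  val : Flags L → ℕ → Pure S
  val ∅               = var
  val (good abst W f) = exts (val f)
  val (good abbr V f) = ⟦ V ⟧ (val f) ∙ val f
  val (junk b V f)    = var 0 ∙ val f

  ⟪_⟫ : Term S → Flags L → Pure S
  ⟪ T ⟫ f = ⟦ T ⟧ (val f)

  ctx : Flags L → List (Pure S)
  ctx ∅               = []
  ctx (good abst W f) = ⟪ W ⟫ f ∷ ctx f
  ctx (good abbr V f) = ctx f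
  ctx (junk b V f)    = ctx f

  -- The rules of validity with each pair of reductions replaced by conversions of pure terms, which
  -- are stable under well-typed substitution.
  data Typed : Flags L → Term S → Set where
    gSort : ∀ {s} → Typed f (sort s)
    gVar0 : Typed f V → Typed (good b V f) (var 0)
    gVarS : Typed f (var i) → Typed (good b V f) (var (suc i))
    gVarJ : Typed f (var i) → Typed (junk b V f) (var (suc i))
    gBind : Typed f V → Typed (good b V f) T → Typed f (bind b V T)
    gCast : Typed f U → Typed f T → ctx f ⊢ ⟪ U ⟫ f ≃ τ (ctx f) (⟪ T ⟫ f) → Typed f (cast U T)
    gApp  : ∀ {W₀ U₀} → Typed f V → Typed f T → A n →
            ctx f ⊢ ty n (ctx f) (⟪ T ⟫ f) ≃ lam W₀ U₀ →
            ctx f ⊢ W₀ ≃ τ (ctx f) (⟪ V ⟫ f) → Typed f (app V T)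

  -- Relates `renT ξ T` in `f` to `renT ζ T` in `f′`, with `σ` acting on pure variables. `ξ = id`,
  -- `ζ = suc` is weakening; the reverse is the strengthening behind `zeta`; `id` twice changes
  -- entries in place. The conditions concern variables typed in `f`, so junk values are
  -- unconstrained.
  record Map (f : Flags L) (f′ : Flags L′) (ξ ζ : ℕ → ℕ) (σ : ℕ → Pure S) : Set where
    field
      wt    : SubWt (ctx f) (ctx f′) σ
      var-≃ : ∀ i → Typed f (var (ξ i)) → ctx f′ ⊢ sub σ (val f (ξ i)) ≃ val f′ (ζ i)
      var-Typed : ∀ i → Typed f (var (ξ i)) → Typed f′ (var (ζ i))
  open Map

  under : Bind → (ℕ → Pure S) → ℕ → Pure S
  under abst σ = exts σ
  under abbr σ = σ

  map-ext : ∀ b → Map f f′ ξ ζ σ → ctx f′ ⊢ sub σ (⟪ V ⟫ f) ≃ ⟪ V₁ ⟫ f′ → Typed f′ V₁ →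
            Map (good b V f) (good b V₁ f′) (ext ξ) (ext ζ) (under b σ)
  map-ext abst m p v .wt = cons-wt (m .wt) (≃sym p)
  map-ext abbr m p v .wt = m .wt
  map-ext abst m p v .var-≃ zero x = ≃refl
  map-ext {f = f} {ξ = ξ} {σ = σ} abst m p v .var-≃ (suc i) (gVarS x) =
    ≃trans (≡⇒≃ (exts-suc σ (val f (ξ i)))) (≃ren suc-wt (m .var-≃ i x))
  map-ext abbr m p v .var-≃ zero x = p
  map-ext abbr m p v .var-≃ (suc i) (gVarS x) = m .var-≃ i x
  map-ext b m p v .var-Typed zero x = gVar0 v
  map-ext b m p v .var-Typed (suc i) (gVarS x) = gVarS (m .var-Typed i x)

  -- Side conditions move along because `τ` and `ty` commute with `σ` up to `≃` and respect `≃`.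
  transport : Map f f′ ξ ζ σ → ∀ T → Typed f (renT ξ T) →
              ctx f′ ⊢ sub σ (⟪ renT ξ T ⟫ f) ≃ ⟪ renT ζ T ⟫ f′ × Typed f′ (renT ζ T)
  transport m (sort s) gSort = ≃refl , gSort
  transport m (var i) x = m .var-≃ i x , m .var-Typed i x
  transport {f = f} {ξ = ξ} m (app V T) (gApp {n = n} v t a p q) with transport m V v | transport m T t
  ... | e , v′ | d , t′ = ≃app e d ,
    gApp v′ t′ a
      (≃trans (≃ty n (≃sym d)) (≃trans (ty-sub (m .wt) n _) (≃sub (m .wt) p)))
      (≃trans (≃sub (m .wt) q) (≃trans (≃sym (τ-sub (m .wt) (⟪ renT ξ V ⟫ f))) (≃τ e)))
  transport m (bind abst V T) (gBind v t) with transport m V v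
  ... | e , v′ with transport (map-ext abst m e v′) T t
  ... | d , t′ = ≃lam e d , gBind v′ t′
  transport m (bind abbr V T) (gBind v t) with transport m V v
  ... | e , v′ with transport (map-ext abbr m e v′) T t
  ... | d , t′ = d , gBind v′ t′
  transport {f = f} {ξ = ξ} m (cast U T) (gCast u t p) with transport m U u | transport m T t
  ... | e , u′ | d , t′ = ≃cast e d ,
    gCast u′ t′ (≃trans (≃sym e)
      (≃trans (≃sub (m .wt) p) (≃trans (≃sym (τ-sub (m .wt) (⟪ renT ξ T ⟫ f))) (≃τ d))))

  transport-id : Map f f′ id id σ → Typed f T → ctx f′ ⊢ sub σ (⟪ T ⟫ f) ≃ ⟪ T ⟫ f′ × Typed f′ T
  transport-id {f = f} {f′ = f′} {σ = σ} {T = T} m t =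
    subst (λ X → ctx f′ ⊢ sub σ (⟪ X ⟫ f) ≃ ⟪ X ⟫ f′ × Typed f′ X) (renT-id (λ _ → refl) T)
      (transport m T (subst (Typed f) (sym (renT-id (λ _ → refl) T)) t))

  transport-var : Map f f′ id id var → Typed f T → ctx f′ ⊢ ⟪ T ⟫ f ≃ ⟪ T ⟫ f′ × Typed f′ T
  transport-var m t with transport-id m t
  ... | e , t′ = ≃unsub e , t′

  transport-lift : Map f f′ id suc σ → Typed f T →
                   ctx f′ ⊢ sub σ (⟪ T ⟫ f) ≃ ⟪ lift 0 T ⟫ f′ × Typed f′ (lift 0 T)
  transport-lift {f = f} {f′ = f′} {σ = σ} {T = T} m t =
    subst₂ (λ X Y → ctx f′ ⊢ sub σ (⟪ X ⟫ f) ≃ ⟪ Y ⟫ f′ × Typed f′ Y)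
      (renT-id (λ _ → refl) T) (sym (lift≗renT (λ _ → refl) T))
      (transport m T (subst (Typed f) (sym (renT-id (λ _ → refl) T)) t))

  transport-unlift : Map f f′ suc id σ → Typed f (lift 0 T) →
                     ctx f′ ⊢ sub σ (⟪ lift 0 T ⟫ f) ≃ ⟪ T ⟫ f′ × Typed f′ T
  transport-unlift {f = f} {f′ = f′} {σ = σ} {T = T} m t =
    subst₂ (λ X Y → ctx f′ ⊢ sub σ (⟪ X ⟫ f) ≃ ⟪ Y ⟫ f′ × Typed f′ Y)
      (sym (lift≗renT (λ _ → refl) T)) (renT-id (λ _ → refl) T)
      (transport m T (subst (Typed f) (lift≗renT (λ _ → refl) T) t))

  map-id : Map f f id id var
  map-id .wt = id-wt
  map-id .var-≃ i x = ≡⇒≃ (sub-id _)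
  map-id .var-Typed i x = x

  -- `map-ext` would yield `ext id` and `exts var`, which agree with `id` and `var` only pointwise.
  map-good : Map f f′ id id var → ctx f′ ⊢ ⟪ V ⟫ f ≃ ⟪ V₁ ⟫ f′ → Typed f′ V₁ →
             Map (good b V f) (good b V₁ f′) id id var
  map-good {b = abst} m p v .wt = cons-conv (m .wt) (≃sym p)
  map-good {b = abbr} m p v .wt = m .wt
  map-good {b = abst} m p v .var-≃ zero x = ≃refl
  map-good {f = f} {b = abst} m p v .var-≃ (suc i) (gVarS x) =
    ≃trans (≡⇒≃ (sub-id _ ∙≡ cong (ren suc) (sym (sub-id (val f i)))))
      (≃ren suc-wt (m .var-≃ i x))
  map-good {b = abbr} m p v .var-≃ zero x = ≃trans (≡⇒≃ (sub-id _)) p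
  map-good {b = abbr} m p v .var-≃ (suc i) (gVarS x) = m .var-≃ i x
  map-good m p v .var-Typed zero x = gVar0 v
  map-good m p v .var-Typed (suc i) (gVarS x) = gVarS (m .var-Typed i x)

  map-junk : Map f f′ id id var → Map (junk b V f) (junk b V₁ f′) id id var
  map-junk m .wt = m .wt
  map-junk m .var-≃ (suc i) (gVarJ x) = m .var-≃ i x
  map-junk m .var-Typed (suc i) (gVarJ x) = gVarJ (m .var-Typed i x)

  shift : Bind → ℕ → Pure S
  shift abst i = var (suc i)
  shift abbr i = var i

  ren-suc≡shift : ∀ X → ren suc X ≡ sub (shift abst) X
  ren-suc≡shift = ren≗sub (λ _ → refl)

  weaken : ∀ b V → Map f (good b V f) id suc (shift b)
  weaken {f = f} abst V .wt .sub-at x = ≡⇒≃ (ren-suc≡shift (look (ctx f) x))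
  weaken abst V .var-≃ i x = ≡⇒≃ (sym (ren-suc≡shift _))
  weaken abst V .var-Typed i x = gVarS x
  weaken abbr V .wt = id-wt
  weaken abbr V .var-≃ i x = ≡⇒≃ (sub-id _)
  weaken abbr V .var-Typed i x = gVarS x

  weaken-junk : Map f (junk b V f) id suc var
  weaken-junk .wt = id-wt
  weaken-junk .var-≃ i x = ≡⇒≃ (sub-id _)
  weaken-junk .var-Typed i x = gVarJ x

  strengthen : Map (good abbr V f) f suc id var
  strengthen .wt = id-wt
  strengthen .var-≃ i x = ≡⇒≃ (sub-id _)
  strengthen .var-Typed i (gVarS x) = x

  -- In both environments x has type W, so that nothing but the value of x changes.
  decl⇒def : Typed f (cast W V) →
             Map (good abst W f) (good abbr (cast W V) f) id id (⟪ cast W V ⟫ f ∙ var)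
  decl⇒def v .wt = inst-wt ≃refl
  decl⇒def v .var-≃ zero x = ≃refl
  decl⇒def v .var-≃ (suc i) x = ≡⇒≃ (inst-suc _ _)
  decl⇒def v .var-Typed zero x = gVar0 v
  decl⇒def v .var-Typed (suc i) (gVarS x) = gVarS x

  -- Steps of typed terms compute iterated types and preserve typing.

  lift-var : Map f f′ id suc σ → ∀ n → Typed f (var i) → ctx f ⊢ ty n (ctx f) (val f i) ≃ ⟪ T ⟫ f →
             Typed f T → ctx f′ ⊢ ty n (ctx f′) (val f′ (suc i)) ≃ ⟪ lift 0 T ⟫ f′ × Typed f′ (lift 0 T)
  lift-var m n x p t with transport-lift m t
  ... | e , t′ =
    ≃trans (≃ty n (≃sym (m .var-≃ _ x))) (≃trans (ty-sub (m .wt) n _) (≃trans (≃sub (m .wt) p) e)) , t′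

  ty-lam-≃ : ∀ {Γ W U T} n → Γ ⊢ T ≃ lam W U → Γ ⊢ ty n Γ T ≃ lam W (ty n (W ∷ Γ) U)
  ty-lam-≃ n p = ≃trans (≃ty n p) (≡⇒≃ (ty-lam n _ _))

  ty-swap : ∀ m n Γ (T : Pure S) → ty m Γ (ty n Γ T) ≡ ty n Γ (ty m Γ T)
  ty-swap m n Γ T = sym (ty-+ n m Γ T) ∙≡
    (cong (λ k → ty k Γ T) (+-comm n m) ∙≡ ty-+ m n Γ T)

  -- Both halves are proved at once: the conversion obtained for a subterm repairs the side
  -- conditions of the rule above it.
  step-sound : Typed {L} f T₁ → Step next L T₁ n T₂ → ctx f ⊢ ty n (ctx f) (⟪ T₁ ⟫ f) ≃ ⟪ T₂ ⟫ f × Typed f T₂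
  step-sound (gApp {n = n} v (gBind w t) a p q) beta =
    ≃trans (≃step (▷beta (▷refl _) (▷refl _) (▷refl _))) (proj₁ r) , gBind c (proj₂ r)
    where
    -- Taking types of a λ keeps its domain, so `p` and injectivity identify `W` with the expected
    -- domain, and `q` identifies that with the type of `V`.
    c = gCast w v (≃trans (lam-injective (≃trans (≡⇒≃ (sym (ty-lam n _ _))) p)) q)
    r = transport-id (decl⇒def c) t
  step-sound (gVar0 {V = V} v) delta with transport-lift (weaken abbr V) v
  ... | e , v′ = ≃unsub e , v′
  step-sound (gBind v t) zeta with transport-unlift strengthen t
  ... | e , t′ = ≃unsub e , t′
  step-sound (gApp v (gBind {V = W} w t) a p q) theta with transport-lift (weaken abbr W) v
  ... | e , v′ = ≃app e′ ≃refl , gBind w (gApp v′ t a p (≃trans q (≃τ e′)))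
    where e′ = ≃unsub e
  step-sound (gCast u t p) eps = ≃step (▷eps p (▷refl _)) , t
  step-sound gSort sortS = ≃refl , gSort
  step-sound (gVar0 {V = V} v) ldec with transport-lift (weaken abst V) v
  ... | e , v′ = ≃trans (≡⇒≃ (ren-suc≡shift _)) e , v′
  step-sound (gCast u t p) ecast = ≃refl , u
  step-sound {n = n} (gVarS {b = b} {V = V} x) (lref s) with step-sound x s
  ... | p , t = lift-var (weaken b V) n x p t
  step-sound {n = n} (gVarJ x) (lref s) with step-sound x s
  ... | p , t = lift-var weaken-junk n x p t
  step-sound (gApp v t a p q) (appV s) with step-sound v s
  ... | e , v′ = ≃app e ≃refl , gApp v′ t a p (≃trans q (≃τ e))
  step-sound {n = n} (gApp {n = m} v t a p q) (appT s) with step-sound t s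
  ... | e , t′ = ≃trans (≡⇒≃ (ty-app n _ _)) (≃app ≃refl e) ,
    gApp v t′ a (≃trans (≃ty m (≃sym e)) (≃trans (≡⇒≃ (ty-swap m n _ _)) (ty-lam-≃ n p))) q
  step-sound (gBind {b = abst} v t) (bindV s) with step-sound v s
  ... | e , v′ with transport-var (map-good map-id e v′) t
  ... | d , t′ = ≃lam e d , gBind v′ t′
  step-sound (gBind {b = abbr} v t) (bindV s) with step-sound v s
  ... | e , v′ with transport-var (map-good map-id e v′) t
  ... | d , t′ = d , gBind v′ t′
  step-sound {n = n} (gBind {b = abst} v t) (bindT s) with step-sound t s
  ... | e , t′ = ≃trans (≡⇒≃ (ty-lam n _ _)) (≃lam ≃refl e) , gBind v t′
  step-sound (gBind {b = abbr} v t) (bindT s) with step-sound t s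
  ... | e , t′ = e , gBind v t′
  step-sound (gCast u t p) (castU s) with step-sound u s
  ... | e , u′ = ≃cast e ≃refl , gCast u′ t (≃trans (≃sym e) p)
  step-sound (gCast u t p) (castT s) with step-sound t s
  ... | e , t′ = ≃cast ≃refl e , gCast u t′ (≃trans p (≃τ e))
  step-sound (gCast u t p) (castUT r s) with step-sound u r | step-sound t s
  ... | d , u′ | e , t′ =
    -- The type `U₁` of the redex converts to `T₂`, which is the contraction of the new cast; its
    -- guard `c` is `U₂ ≃ τ U₁ ≃ τ T₂`.
    ≃trans p (≃trans e (≃sym (≃step (▷eps c (▷refl _))))) , gCast u′ t′ c
    where c = ≃trans (≃sym d) (≃τ (≃trans p e))

  steps-sound : Typed {L} f T₁ → Steps next L T₁ n T₂ → ctx f ⊢ ty n (ctx f) (⟪ T₁ ⟫ f) ≃ ⟪ T₂ ⟫ f × Typed f T₂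
  steps-sound t refl0 = ≃refl , t
  steps-sound t (step s) = step-sound t s
  steps-sound t (trans {n₁ = m} {n₂ = n} p q) with steps-sound t p
  ... | d , t₁ with steps-sound t₁ q
  ... | e , t₂ = ≃trans (≡⇒≃ (ty-+ m n _ _)) (≃trans (≃ty n d) e) , t₂

  -- From typing back to validity.

  progress : Typed {L} f T → ∃ λ T₁ → Steps next L T 1 T₁
  progress gSort = _ , step sortS
  progress (gVar0 {b = abst} v) = _ , step ldec
  -- The type of a defined variable is that of its value, so `delta` has to come first.
  progress (gVar0 {b = abbr} v) = _ , trans (step delta) (steps-lift (proj₂ (progress v)))
  progress (gVarS x) = _ , steps-lift (proj₂ (progress x))
  progress (gVarJ x) = _ , steps-lift (proj₂ (progress x))
  progress (gBind v t) = _ , steps-map (bind _ _) bindT (proj₂ (progress t))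
  progress (gCast u t p) = _ , step ecast
  progress (gApp v t a p q) = _ , steps-map (app _) appT (proj₂ (progress t))

  progress* : ∀ n → Typed {L} f T → ∃ λ T₁ → Steps next L T n T₁
  progress* zero    t = _ , refl0
  progress* (suc n) t with progress t
  ... | _ , p with progress* n (proj₂ (steps-sound t p))
  ... | _ , q = _ , trans p q

  -- The position in L of the declaration behind each pure variable.
  pos : Flags L → ℕ → ℕ
  pos ∅               = id
  pos (good abst W f) = ext (pos f)
  pos (good abbr V f) = suc ∘ pos f
  pos (junk b V f)    = suc ∘ pos f

  -- Definitions are unfolded by `delta` and dropped by `zeta`. With `embed-▷*`, every pure reduct
  -- of the translation is thus reached from the term itself.
  unfold : Typed {L} f T → Steps next L T 0 (embed (pos f) (⟪ T ⟫ f))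
  unfold gSort = refl0
  unfold (gVar0 {b = abst} v) = refl0
  unfold (gVar0 {f = f} {V = V} {b = abbr} v) =
    trans (step delta) (steps-lift (unfold v) ⟶*≡ lift-embed (pos f) (⟪ V ⟫ f))
  unfold (gVarS {f = f} {b = abst} x) = steps-lift (unfold x) ⟶*≡ lift-embed-ext (pos f) (val f _)
  unfold (gVarS {f = f} {b = abbr} x) = steps-lift (unfold x) ⟶*≡ lift-embed (pos f) (val f _)
  unfold (gVarJ {f = f} x) = steps-lift (unfold x) ⟶*≡ lift-embed (pos f) (val f _)
  unfold (gBind {b = abst} v t) = bind* (unfold v) (unfold t)
  unfold {f = f} (gBind {b = abbr} v t) =
    trans (bind* refl0 (unfold t)) (step (zeta≡ (sym (lift-embed (pos f) _))))
  unfold (gCast u t p) = cast* (unfold u) (unfold t)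
  unfold (gApp v t a p q) = app* (unfold v) (unfold t)

  unfold▷* : ∀ {Γ X} → Typed {L} f T → Γ ⊢ ⟪ T ⟫ f ▷* X → Steps next L T 0 (embed (pos f) X)
  unfold▷* {f = f} t p = trans (unfold t) (embed-▷* p (pos f))

  -- `progress` realises a type by actual steps, Church-Rosser turns the conversion into a common
  -- pure reduct, and `unfold▷*` reaches it from both sides.
  Typed⇒Valid : Typed {L} f T → Valid next A L T
  Typed⇒Valid gSort = vSort
  Typed⇒Valid (gVar0 v) = vVar0 (Typed⇒Valid v)
  Typed⇒Valid (gVarS x) = vVarS (Typed⇒Valid x)
  Typed⇒Valid (gVarJ x) = vVarS (Typed⇒Valid x)
  Typed⇒Valid (gBind v t) = vBind (Typed⇒Valid v) (Typed⇒Valid t)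
  Typed⇒Valid (gCast u t p) with progress t
  ... | _ , r with steps-sound t r
  ... | d , t₁ with church-rosser (≃trans (≃sym d) (≃sym p))
  ... | _ , x , y = vCast (Typed⇒Valid u) (Typed⇒Valid t) (r ▸₀ unfold▷* t₁ x) (unfold▷* u y)
  Typed⇒Valid {f = f} (gApp {n = n} v t a p q) with progress* n t | progress v
  ... | _ , r | _ , s with steps-sound t r | steps-sound v s
  ... | d , t₁ | e , v₁ with church-rosser (≃trans (≃sym d) p)
  ... | _ , x , y with lam▷* y
  -- The λ now reached has a domain merely convertible to the type of `V`; a second use of
  -- Church-Rosser makes the two meet.
  ... | _ , _ , refl , c with church-rosser (≃trans (≃sym c) (≃trans q e))
  ... | _ , z , w = vApp (Typed⇒Valid v) (Typed⇒Valid t) a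
    (r ▸₀ trans (unfold▷* t₁ x) (bind* (embed-▷* z (pos f)) refl0)) (s ▸₀ unfold▷* v₁ w)

  -- From validity to typing: the choice of flags.

  infix 3 _⊑_
  data _⊑_ : Flags L → Flags L → Set where
    ∅  : ∅ ⊑ ∅
    gg : f ⊑ g → good b V f ⊑ good b V g
    jg : f ⊑ g → junk b V f ⊑ good b V g
    jj : f ⊑ g → junk b V f ⊑ junk b V g

  ⊑-refl : (f : Flags L) → f ⊑ f
  ⊑-refl ∅            = ∅
  ⊑-refl (good b V f) = gg (⊑-refl f)
  ⊑-refl (junk b V f) = jj (⊑-refl f)

  ⊑-trans : f ⊑ g → g ⊑ h → f ⊑ h
  ⊑-trans ∅      ∅      = ∅
  ⊑-trans (gg p) (gg q) = gg (⊑-trans p q)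
  ⊑-trans (jg p) (gg q) = jg (⊑-trans p q)
  ⊑-trans (jj p) (jg q) = jg (⊑-trans p q)
  ⊑-trans (jj p) (jj q) = jj (⊑-trans p q)

  -- Quantifying over all larger flags lets the flags found for different subterms be merged.
  TypedAbove : Flags L → Term S → Set
  TypedAbove f T = ∀ g → f ⊑ g → Typed g T

  -- Keeps the typing of good entries at hand for environment steps that take place inside them.
  data GoodTyped : Flags L → Set where
    ∅    : GoodTyped ∅
    good : GoodTyped f → TypedAbove f V → GoodTyped (good b V f)
    junk : GoodTyped f → GoodTyped (junk b V f)

  join : GoodTyped {L} f → GoodTyped {L} g → ∃ λ h → GoodTyped h × f ⊑ h × g ⊑ h
  join ∅ ∅ = _ , ∅ , ∅ , ∅
  join (good p x) (good q y) with join p q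
  ... | _ , o , a , b = _ , good o (λ k c → x k (⊑-trans a c)) , gg a , gg b
  join (good p x) (junk q) with join p q
  ... | _ , o , a , b = _ , good o (λ k c → x k (⊑-trans a c)) , gg a , jg b
  join (junk p) (good q y) with join p q
  ... | _ , o , a , b = _ , good o (λ k c → y k (⊑-trans b c)) , jg a , gg b
  join (junk p) (junk q) with join p q
  ... | _ , o , a , b = _ , junk o , jj a , jj b

  all-junk : (L : Env S) → ∃ λ (f : Flags L) → GoodTyped f
  all-junk ∅            = _ , ∅
  all-junk (snoc L b V) = _ , junk (proj₂ (all-junk L))

  join₂ : (∃ λ (f : Flags L) → GoodTyped f × TypedAbove f T₁) →
          (∃ λ (f : Flags L) → GoodTyped f × TypedAbove f T₂) →
          ∃ λ (f : Flags L) → GoodTyped f × TypedAbove f T₁ × TypedAbove f T₂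
  join₂ (_ , o , s) (_ , p , t) with join o p
  ... | _ , q , a , b = _ , q , (λ g c → s g (⊑-trans a c)) , (λ g c → t g (⊑-trans b c))

  Valid⇒Typed : Valid next A L T → ∃ λ (f : Flags L) → GoodTyped f × TypedAbove f T
  Valid⇒Typed vSort = _ , proj₂ (all-junk _) , λ _ _ → gSort
  Valid⇒Typed (vVar0 v) with Valid⇒Typed v
  ... | f , o , p = good _ _ f , good o p , λ { _ (gg c) → gVar0 (p _ c) }
  Valid⇒Typed (vVarS v) with Valid⇒Typed v
  -- Nothing is known of the entry skipped over, hence junk; a larger flagging may still make it
  -- good.
  ... | f , o , p = junk _ _ f , junk o , λ { _ (jg c) → gVarS (p _ c) ; _ (jj c) → gVarJ (p _ c) }
  Valid⇒Typed (vBind v t) with Valid⇒Typed v | Valid⇒Typed t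
  ... | f , o , p | good _ _ g , good q _ , r with join o q
  ...   | h , k , a , c = h , k , λ i d →
          gBind (p i (⊑-trans a d)) (r _ (gg (⊑-trans c d)))
  -- The binder came out as junk, but `V` is typed, so `jg` raises it to good as `gBind` demands.
  Valid⇒Typed (vBind v t) | f , o , p | junk _ _ g , junk q , r with join o q
  ...   | h , k , a , c = h , k , λ i d →
          gBind (p i (⊑-trans a d)) (r _ (jg (⊑-trans c d)))
  Valid⇒Typed (vCast u t r s) with join₂ (Valid⇒Typed u) (Valid⇒Typed t)
  ... | f , o , p , q = f , o , λ g c →
    gCast (p g c) (q g c)
      (≃trans (proj₁ (steps-sound (p g c) s)) (≃sym (proj₁ (steps-sound (q g c) r))))
  Valid⇒Typed (vApp v t a r s) with join₂ (Valid⇒Typed v) (Valid⇒Typed t)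
  ... | f , o , p , q = f , o , λ g c →
    gApp (p g c) (q g c) a (proj₁ (steps-sound (q g c) r)) (≃sym (proj₁ (steps-sound (p g c) s)))

  -- Environment reduction, confluence and preservation.

  record EnvRed (f : Flags L) (f′ : Flags L′) : Set where
    field
      forth : Map f f′ id id var
      back  : SubWt (ctx f′) (ctx f) var
      pos-≡ : pos f ≡ pos f′
  open EnvRed

  -- A step in a good entry is followed by `step-sound`, and one in a junk entry changes no value.
  -- `back` brings conversions home to `ctx f`, where results from two different reducts of `L` can
  -- be compared; kinds and flags persist, so `pos` is the same for both.
  estep-sound : GoodTyped {L} f → EStep next L L′ → ∃ λ (f′ : Flags L′) → EnvRed f f′
  estep-sound {f = good b V f} (good o v) (envK s) with estep-sound o s | v f (⊑-refl f)
  ... | f′ , r | x with transport-var (r .forth) x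
  ... | e , v′ = good b V f′ , record
    { forth = map-good (r .forth) e v′
    ; back  = back′ b
    ; pos-≡ = pos-≡′ b
    }
    where
    back′ : ∀ b → SubWt (ctx (good b V f′)) (ctx (good b V f)) var
    back′ abst = cons-conv (r .back) (≃conv (r .back) e)
    back′ abbr = r .back
    pos-≡′ : ∀ b → pos (good b V f) ≡ pos (good b V f′)
    pos-≡′ abst = cong ext (r .pos-≡)
    pos-≡′ abbr = cong (suc ∘_) (r .pos-≡)
  estep-sound {f = junk b V f} (junk o) (envK s) with estep-sound o s
  ... | f′ , r = junk b V f′ , record
    { forth = map-junk (r .forth)
    ; back  = r .back
    ; pos-≡ = cong (suc ∘_) (r .pos-≡)
    }
  estep-sound {f = good b V f} (good o v) (envV {V₂ = V₂} s) with step-sound (v f (⊑-refl f)) s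
  ... | e , v′ = good b V₂ f , record
    { forth = map-good map-id e v′
    ; back  = back′ b
    ; pos-≡ = pos-≡′ b
    }
    where
    back′ : ∀ b → SubWt (ctx (good b V₂ f)) (ctx (good b V f)) var
    back′ abst = cons-conv id-wt e
    back′ abbr = id-wt
    pos-≡′ : ∀ b → pos (good b V f) ≡ pos (good b V₂ f)
    pos-≡′ abst = refl
    pos-≡′ abbr = refl
  estep-sound {f = junk b V f} (junk o) (envV {V₂ = V₂} s) = junk b V₂ f , record
    { forth = map-junk map-id
    ; back  = id-wt
    ; pos-≡ = refl
    }

  -- After the given `m` steps in `L`, `n` further ones in `L′` bring the run to the `(m + n)`-fold
  -- type of `T`, compared in the original context.
  continue : ∀ m n → Typed {L} f T → EnvRed {L′ = L′} f f′ → Steps next L T m T₁ →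
             ∃ λ T₂ → Steps next L′ T₁ n T₂ × Typed f′ T₂ × ctx f ⊢ ty (m + n) (ctx f) (⟪ T ⟫ f) ≃ ⟪ T₂ ⟫ f′
  continue {f = f} {T₁ = T₁} m n t r s with steps-sound t s
  ... | d , t₁ with transport-var (r .forth) t₁
  ... | e , t₁′ with progress* n t₁′
  ... | T₂ , s′ with steps-sound t₁′ s′
  ... | c , t₂ = T₂ , s′ , t₂ ,
    ≃trans (≡⇒≃ (ty-+ m n _ _)) (≃trans (≃ty n d)
      (≃trans (ty-conv (r .back) n (⟪ T₁ ⟫ f)) (≃conv (r .back) (≃trans (≃ty n e) c))))

  m+[n∸m]≡n+[m∸n] : ∀ m n → m + (n ∸ m) ≡ n + (m ∸ n)
  m+[n∸m]≡n+[m∸n] zero    zero    = refl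
  m+[n∸m]≡n+[m∸n] zero    (suc n) = cong suc (sym (+-identityʳ n))
  m+[n∸m]≡n+[m∸n] (suc m) zero    = cong suc (+-identityʳ m)
  m+[n∸m]≡n+[m∸n] (suc m) (suc n) = cong suc (m+[n∸m]≡n+[m∸n] m n)

  -- Each run is prolonged to the larger of the two counts, so both ends convert to the same
  -- iterated type of `T`. Church-Rosser gives a common pure reduct, read back identically in `L₁`
  -- and `L₂` by `pos-≡`.
  rt-confluence : ∀ {L₁ L₂ n₁ n₂} → Valid next A L T → EStep next L L₁ → EStep next L L₂ →
    Steps next L T n₁ T₁ → Steps next L T n₂ T₂ →
    ∃ λ T′ → Steps next L₁ T₁ (n₂ ∸ n₁) T′ × Steps next L₂ T₂ (n₁ ∸ n₂) T′
  rt-confluence {T = T} {n₁ = m} {n₂ = n} v r₁ r₂ s₁ s₂ with Valid⇒Typed v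
  ... | f , o , t with estep-sound o r₁ | estep-sound o r₂
  ... | f₁ , e₁ | f₂ , e₂
    with continue m (n ∸ m) (t f (⊑-refl f)) e₁ s₁ | continue n (m ∸ n) (t f (⊑-refl f)) e₂ s₂
  ... | _ , p₁ , t₁ , c₁ | _ , p₂ , t₂ , c₂
    with church-rosser (≃trans (≃sym c₁)
           (≃trans (≡⇒≃ (cong (λ k → ty k (ctx f) (⟪ T ⟫ f)) (m+[n∸m]≡n+[m∸n] m n))) c₂))
  ... | X , q₁ , q₂ = embed (pos f) X ,
    (p₁ ▸₀ unfold▷* t₁ q₁) ⟶*≡ cong (λ k → embed k X) (sym (e₁ .pos-≡)) ,
    (p₂ ▸₀ unfold▷* t₂ q₂) ⟶*≡ cong (λ k → embed k X) (sym (e₂ .pos-≡))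

  preservation : ∀ {L₂} → Valid next A L T → EStep next L L₂ → Step next L T n T₂ → Valid next A L₂ T₂
  preservation v r s with Valid⇒Typed v
  ... | f , o , t with estep-sound o r
  ... | _ , e = Typed⇒Valid (proj₂ (transport-var (e .forth) (proj₂ (step-sound (t f (⊑-refl f)) s))))

theorem5p1 : (S : Set) → DecidableEquality S → S → (next : S → S) →
    (A : ℕ → Set) (L : Env S) (T : Term S) → Valid next A L T →
    (∀ (L₁ L₂ : Env S) (T₁ T₂ : Term S) (n₁ n₂ : ℕ) →
    EStep next L L₁ → EStep next L L₂ →
    Steps next L T n₁ T₁ → Steps next L T n₂ T₂ →
    ∃ λ T′ → Steps next L₁ T₁ (n₂ ∸ n₁) T′ × Steps next L₂ T₂ (n₁ ∸ n₂) T′)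
    × (∀ (L₂ : Env S) (T₂ : Term S) (n : ℕ) →
    EStep next L L₂ → Step next L T n T₂ → Valid next A L₂ T₂)
theorem5p1 S _ _ next A L T v =
  (λ _ _ _ _ _ _ → rt-confluence v) , (λ _ _ _ → preservation v)
  where open Typing next A
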